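{- For any finite set $\mathcal{I}$ of closed intervals on the real line and any $k \in \mathbb{N}$, there exists a balanced $k$-coloring of $\mathcal{I}$.
   Context: Let $\mathcal{I}=\{I_1,\dots,I_n\}$ be a finite set of closed intervals $[\ell,r]\subset\mathbb{R}$ and $K=\{1,\dots,k\}$. A $k$-coloring is a map $\chi:\mathcal{I}\to K$. For $x\in\mathbb{R}$ and $i\in K$, let $c_i(x)$ be the number of intervals of $\mathcal{I}$ that contain $x$ and have color $i$. The imbalance at $x$ is $\mathrm{imb}(x)=\max_{i,j\in K}|c_i(x)-c_j(x)|$, and the imbalance of $\chi$ is $\mathrm{imb}(\chi)=\max_{x\in\mathbb{R}}\mathrm{imb}(x)$. A $k$-coloring is called balanced if its imbalance is at most one. -}

module Defs where

open import Level using (Lift; lift; lower; 0ℓ) renaming (suc to lsuc)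
open import Axiom.ExcludedMiddle using (ExcludedMiddle)
open import Data.Fin using (Fin; _≟_)
open import Data.List using (allFin; cartesianProduct; filter; length; map)
open import Data.List.Extrema.Nat using (max)
open import Data.Nat using (ℕ; ∣_-_∣) renaming (_≤_ to _≤ⁿ_)
open import Data.Product using (∃; ∃-syntax; _×_; _,_)
open import Data.Rational using (ℚ; _<_)
open import Data.Sum using (_⊎_)
open import Function.Bundles using (_⇔_)
open import Relation.Binary.PropositionalEquality using (_≡_)
open import Relation.Nullary using (¬_; Dec)
open import Relation.Nullary.Decidable using (map′; _×-dec_)
open import Relation.Unary using (Pred)

-- Real numbers as two-sided Dedekind cuts: L q means q < x, U q means x < q.
record ℝ : Set₁ where
  field
    L U         : Pred ℚ 0ℓ
    L-inhabited : ∃ L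
    U-inhabited : ∃ U
    L-rounded   : ∀ q → L q ⇔ (∃[ r ] (q < r × L r))
    U-rounded   : ∀ q → U q ⇔ (∃[ r ] (r < q × U r))
    disjoint    : ∀ q → ¬ (L q × U q)
    located     : ∀ q r → q < r → L q ⊎ U r

infix 4 _≤_ _≈_ _∈_ _≈ᴵ_

_≤_ : ℝ → ℝ → Set
x ≤ y = ∀ q → ℝ.L x q → ℝ.L y q

-- Equality of reals; propositional equality of cuts would be too fine.
_≈_ : ℝ → ℝ → Set
x ≈ y = x ≤ y × y ≤ x

record ClosedInterval : Set₁ where
  field
    left right : ℝ
    left≤right : left ≤ right

_∈_ : ℝ → ClosedInterval → Set
x ∈ J = ClosedInterval.left J ≤ x × x ≤ ClosedInterval.right J

_≈ᴵ_ : ClosedInterval → ClosedInterval → Set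
J ≈ᴵ J′ = ClosedInterval.left J ≈ ClosedInterval.left J′
        × ClosedInterval.right J ≈ ClosedInterval.right J′

IsMaximumOf : {A : Set₁} → (A → ℕ) → ℕ → Set₁
IsMaximumOf f m = (∃[ x ] f x ≡ m) × (∀ x → f x ≤ⁿ m)

-- Membership of a real in an interval is not decidable constructively, so
-- counting the intervals that contain a given real uses excluded middle.
module _ (em : ExcludedMiddle (lsuc 0ℓ)) where

  _∈?_ : (x : ℝ) (J : ClosedInterval) → Dec (x ∈ J)
  x ∈? J = map′ lower lift (em {Lift (lsuc 0ℓ) (x ∈ J)})

  module _ {n k : ℕ} (I : Fin n → ClosedInterval) (χ : Fin n → Fin k) where

    colourCount : Fin k → ℝ → ℕ
    colourCount i x = length (filter (λ a → (x ∈? I a) ×-dec (χ a ≟ i)) (allFin n))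

    -- The first argument of max is harmless: all entries are ≥ 0.
    imbalanceAt : ℝ → ℕ
    imbalanceAt x =
      max 0 (map (λ (i , j) → ∣ colourCount i x - colourCount j x ∣)
                 (cartesianProduct (allFin k) (allFin k)))

    IsImbalance : ℕ → Set₁
    IsImbalance = IsMaximumOf imbalanceAt

    Balanced : Set₁
    Balanced = ∃[ m ] (IsImbalance m × m ≤ⁿ 1)

{-# OPTIONS --safe #-}

-- Two colours: encode an interval by its two ends, with opposite signs, so that
-- the signed number of intervals containing x is the sum of the signs of the ends
-- passed by x.  Sort all ends along the line and ask that the ends at positions
-- 2i and 2i+1 have opposite signs too: every prefix sum is then in {-1, 0, 1}.
-- Both requirements can be met, since the graph on the ends made of the two
-- matchings is bipartite.
--
-- k colours (de Werra): as long as some point sees two colours i, j in numbers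
-- differing by at least 2, recolour the intervals of colours i and j by a balanced
-- two-colouring.  Over finitely many points realising all membership patterns, the
-- sum of the squares of the colour counts strictly decreases.
module Submission where

open import Defs renaming (_≤_ to _≤ʳ_; _∈_ to _∈ᴵ_)
open import Level using (Level; Lift; lift; lower; 0ℓ) renaming (suc to lsuc)
open import Axiom.ExcludedMiddle using (ExcludedMiddle)
open import Data.Bool using (Bool; true; false; _∧_; _∨_; if_then_else_; b≤b; f≤t) renaming (_≤_ to _≤ᵇ_)
import Data.Bool.Properties as Bool
open import Data.Empty using (⊥-elim)
open import Data.Fin using (Fin; _≟_) renaming (zero to fzero; suc to fsuc)
open import Data.Fin.Properties using (punchInᵢ≢i)
open import Data.Integer using (ℤ; 0ℤ; +_; -[1+_]; _◃_; ∣_∣) renaming (_+_ to _+ᶻ_)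
import Data.Integer.Properties as ℤ
import Data.Integer.Solver as ℤSolver
open import Data.List using (List; []; _∷_; _++_; map; foldr; length; filter; allFin; cartesianProduct)
open import Data.List.Extrema.Nat using (max≤v⁺)
open import Data.List.Properties using (map-cong)
open import Data.List.Relation.Binary.Permutation.Propositional using (↭-sym; ↭⇒↭ₛ)
open import Data.List.Relation.Binary.Permutation.Propositional.Properties using (map⁺)
import Data.List.Relation.Binary.Permutation.Setoid.Properties as Permutation
open import Data.List.Relation.Unary.All as All using (All; []; _∷_)
import Data.List.Relation.Unary.All.Properties as All
open import Data.List.Relation.Unary.AllPairs as AllPairs using (AllPairs; []; _∷_)
open import Data.List.Relation.Unary.Any as Any using (Any; here; there)
open import Data.List.Relation.Unary.Any.Properties using (++⁺ˡ; ++⁺ʳ)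
open import Data.List.Relation.Unary.Linked.Properties using (Linked⇒AllPairs)
open import Data.List.Relation.Unary.Unique.Propositional using (Unique)
import Data.List.Relation.Unary.Unique.Propositional.Properties as Unique
import Data.List.Sort as Sort
open import Data.Nat using (ℕ; zero; suc; _≤_; _<_; z≤n; s≤s; _+_; _*_; _∸_; ∣_-_∣; NonZero)
open import Data.Nat.Induction using (<-wellFounded)
open import Data.Nat.ListAction using (sum)
import Data.Nat.Properties as ℕ
open import Algebra.Properties.CommutativeMonoid.Sum ℕ.+-0-commutativeMonoid
  using (sum-remove; sum-cong-≗) renaming (sum to ∑)
open import Data.Nat.Solver using (module +-*-Solver)
open import Data.Product using (∃; ∃-syntax; _×_; _,_; proj₁; proj₂)
import Data.Rational as ℚ
open import Data.Rational using (0ℚ; 1ℚ) renaming (_<_ to _<ᵠ_)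
import Data.Rational.Properties as ℚ
open import Data.Sign using (Sign; opposite) renaming (+ to ⊕; - to ⊖; _*_ to _*ˢ_)
import Data.Sign.Properties as Sign
open import Data.Sum as Sum using (_⊎_; inj₁; inj₂)
open import Data.Unit using (⊤; tt)
open import Data.Vec.Functional using (removeAt)
open import Function using (_∘_; id)
open import Function.Bundles using (Equivalence; mk⇔)
open import Function.Definitions using (Injective)
open import Induction.WellFounded using (Acc; acc)
open import Relation.Binary using (DecTotalOrder; DecidableEquality; tri<; tri≈; tri>)
open import Relation.Binary.PropositionalEquality
open import Relation.Nullary using (¬_; Dec; yes; no; does)
open import Relation.Nullary.Decidable
  using (_×-dec_; dec-true; dec-false; map′; ¬?; decidable-stable; toWitness)
open import Relation.Unary using (Pred; Decidable)

-- Balanced two-colourings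

-- Signs are compared inside the pairs at positions 2i and 2i+1 only, never across two pairs: the
-- pairs form a matching. A last unpaired element is free.
Alternating : {C : Set} → (C → Sign) → List C → Set
Alternating s (u ∷ v ∷ E) = s v ≡ opposite (s u) × Alternating s E
Alternating s _           = ⊤

alternating-cong : {C : Set} {s t : C → Sign} {E : List C} →
  All (λ u → s u ≡ t u) E → Alternating s E → Alternating t E
alternating-cong []             _          = tt
alternating-cong (_ ∷ [])       _          = tt
alternating-cong (p ∷ q ∷ ps) (alt , alts) =
  trans (sym q) (trans alt (cong opposite p)) , alternating-cong ps alts

bit : Bool → ℕ
bit b = if b then 1 else 0

signed : Sign → Bool → ℤ
signed s b = s ◃ bit b

signed-opposite : ∀ s b → signed s b +ᶻ signed (opposite s) b ≡ 0ℤ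
signed-opposite ⊕ true  = refl
signed-opposite ⊕ false = refl
signed-opposite ⊖ true  = refl
signed-opposite ⊖ false = refl

∣signed∣≤1 : ∀ s b → ∣ signed s b ∣ ≤ 1
∣signed∣≤1 ⊕ true  = s≤s z≤n
∣signed∣≤1 ⊕ false = z≤n
∣signed∣≤1 ⊖ true  = s≤s z≤n
∣signed∣≤1 ⊖ false = z≤n

sumᶻ : List ℤ → ℤ
sumᶻ = foldr _+ᶻ_ 0ℤ

module _ {C : Set} (s : C → Sign) (v : C → Bool) where

  signedSum : List C → ℤ
  signedSum E = sumᶻ (map (λ u → signed (s u) (v u)) E)

  signedSum-false : ∀ {E} → All (λ u → v u ≤ᵇ false) E → signedSum E ≡ 0ℤ
  signedSum-false [] = refl
  signedSum-false {u ∷ E} (p ∷ ps) with v u | s u | p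
  ... | false | ⊕ | _ = trans (ℤ.+-identityˡ _) (signedSum-false ps)
  ... | false | ⊖ | _ = trans (ℤ.+-identityˡ _) (signedSum-false ps)

  -- `v` holds exactly on an initial segment. Whole pairs inside it cancel and pairs outside it
  -- contribute 0, so at most the first element of one split or incomplete pair survives.
  alternating-bound : ∀ E → AllPairs (λ u w → v w ≤ᵇ v u) E → Alternating s E →
                      ∣ signedSum E ∣ ≤ 1
  alternating-bound []      _ _ = z≤n
  alternating-bound (u ∷ []) _ _ =
    subst (λ z → ∣ z ∣ ≤ 1) (sym (ℤ.+-identityʳ (signed (s u) (v u)))) (∣signed∣≤1 (s u) (v u))
  alternating-bound (u ∷ w ∷ E) ((w≤u ∷ _) ∷ E≤w ∷ desc) (w≡-u , alt)
    with v w | v u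
  ... | false | b = subst (λ z → ∣ z ∣ ≤ 1) (sym eq) (∣signed∣≤1 (s u) b)
    where
    tail≡0 : ∀ t → signed t false +ᶻ signedSum E ≡ 0ℤ
    tail≡0 ⊕ = trans (ℤ.+-identityˡ _) (signedSum-false E≤w)
    tail≡0 ⊖ = trans (ℤ.+-identityˡ _) (signedSum-false E≤w)
    eq : signed (s u) b +ᶻ (signed (s w) false +ᶻ signedSum E) ≡ signed (s u) b
    eq = trans (cong (signed (s u) b +ᶻ_) (tail≡0 (s w))) (ℤ.+-identityʳ _)
  ... | true | true rewrite w≡-u =
    subst (λ z → ∣ z ∣ ≤ 1) (sym eq) (alternating-bound E desc alt)
    where
    eq : signed (s u) true +ᶻ (signed (opposite (s u)) true +ᶻ signedSum E) ≡ signedSum E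
    eq = trans (sym (ℤ.+-assoc (signed (s u) true) _ _))
           (trans (cong (_+ᶻ signedSum E) (signed-opposite (s u) true)) (ℤ.+-identityˡ _))

-- Bipartiteness of the two matchings on the ends

module _ {A : Set} (_≟_ : DecidableEquality A) where

  -- The factor `b` gives the two ends of an interval opposite signs for every `ε`, so only the
  -- consecutive pairs impose conditions.
  endSign : (A → Sign) → A × Sign → Sign
  endSign ε (a , b) = ε a *ˢ b

  _[_≔_] : {B : Set} → (A → B) → A → B → A → B
  (f [ a ≔ b ]) c = if does (c ≟ a) then b else f c

  -- Contracts the path (a , opposite b) — (a , b) — (c , d).
  redirect : A → A × Sign → A × Sign → A × Sign
  redirect a v (a′ , b) = if does (a′ ≟ a) then v else (a′ , b)

  module _ {a c : A} {b d : Sign} (c≢a : c ≢ a) (ε : A → Sign) where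

    -- The value at `a` is solved from the requirement on the pair `(a , b)`, `(c , d)`; as `c ≢ a`,
    -- the sign of `(c , d)` is not disturbed.
    extended : A → Sign
    extended = ε [ a ≔ opposite (ε c *ˢ d) *ˢ b ]

    extended-new : endSign extended (c , d) ≡ opposite (endSign extended (a , b))
    extended-new with c ≟ a | a ≟ a
    ... | yes c≡a | _       = ⊥-elim (c≢a c≡a)
    ... | no _    | no a≢a  = ⊥-elim (a≢a refl)
    ... | no _    | yes _   = sym (begin
      opposite (opposite e *ˢ b *ˢ b)   ≡⟨ cong opposite (Sign.*-assoc (opposite e) b b) ⟩
      opposite (opposite e *ˢ (b *ˢ b)) ≡⟨ cong (λ t → opposite (opposite e *ˢ t)) (Sign.s*s≡+ b) ⟩
      opposite (opposite e *ˢ ⊕)        ≡⟨ cong opposite (Sign.*-identityʳ _) ⟩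
      opposite (opposite e)             ≡⟨ Sign.opposite-involutive e ⟩
      e                                 ∎)
      where
      open ≡-Reasoning
      e = ε c *ˢ d

    -- An end of `a` other than `(a , b)` is `(a , opposite b)`; under `extended` it has the sign of
    -- `(c , d)`, which is what `redirect` puts in its place.
    extended-redirect : ∀ t → (a , b) ≢ t →
      endSign ε (redirect a (c , d) t) ≡ endSign extended t
    extended-redirect (a′ , b′) t≢ with a′ ≟ a
    ... | no _ = refl
    ... | yes refl = flipped (ε c *ˢ d) b b′ (λ b≡b′ → t≢ (cong (a ,_) b≡b′))
      where
      flipped : ∀ e b b′ → b ≢ b′ → e ≡ opposite e *ˢ b *ˢ b′
      flipped e ⊕ ⊕ ne = ⊥-elim (ne refl)
      flipped e ⊖ ⊖ ne = ⊥-elim (ne refl)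
      flipped ⊕ ⊕ ⊖ ne = refl
      flipped ⊖ ⊕ ⊖ ne = refl
      flipped ⊕ ⊖ ⊕ ne = refl
      flipped ⊖ ⊖ ⊕ ne = refl

  -- Excluding `(a , b)` leaves a single end of `a` that can be moved. It lands on `v`, and neither
  -- of the given ends equals `v`.
  redirect-injective : ∀ {a b v} t t′ → (a , b) ≢ t → (a , b) ≢ t′ → v ≢ t → v ≢ t′ →
    t ≢ t′ → redirect a v t ≢ redirect a v t′
  redirect-injective {a} {b} {v} (a₁ , b₁) (a₂ , b₂) t≢ t′≢ v≢t v≢t′ t≢t′ eq
    with a₁ ≟ a | a₂ ≟ a
  ... | no _ | no _ = t≢t′ eq
  ... | yes _ | no _ = v≢t′ eq
  ... | no _ | yes _ = v≢t (sym eq)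
  ... | yes refl | yes refl = third b b₁ b₂ (t≢ ∘ cong (a ,_)) (t′≢ ∘ cong (a ,_)) (t≢t′ ∘ cong (a ,_))
    where
    third : (b b₁ b₂ : Sign) → b ≢ b₁ → b ≢ b₂ → ¬ b₁ ≢ b₂
    third _ ⊕ ⊕ _ _ n = n refl
    third _ ⊖ ⊖ _ _ n = n refl
    third ⊕ ⊕ ⊖ n _ _ = n refl
    third ⊖ ⊕ ⊖ _ n _ = n refl
    third ⊕ ⊖ ⊕ _ n _ = n refl
    third ⊖ ⊖ ⊕ n _ _ = n refl

  module _ {C : Set} where

    redirect-unique : ∀ {a b v} (ρ : C → A × Sign) {E} →
      All (λ t → (a , b) ≢ ρ t) E → All (λ t → v ≢ ρ t) E →
      AllPairs (λ t t′ → ρ t ≢ ρ t′) E →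
      AllPairs (λ t t′ → redirect a v (ρ t) ≢ redirect a v (ρ t′)) E
    redirect-unique ρ [] [] [] = []
    redirect-unique {a} {b} {v} ρ {t ∷ E} (p ∷ ps) (q ∷ qs) (r ∷ rs) =
      first ps qs r ∷ redirect-unique ρ ps qs rs
      where
      first : ∀ {E} → All (λ t → (a , b) ≢ ρ t) E → All (λ t → v ≢ ρ t) E →
        All (λ t′ → ρ t ≢ ρ t′) E → All (λ t′ → redirect a v (ρ t) ≢ redirect a v (ρ t′)) E
      first [] [] [] = []
      first (p′ ∷ ps) (q′ ∷ qs) (r ∷ rs) =
        redirect-injective _ _ p p′ q q′ r ∷ first ps qs rs

    -- The edges joining the two ends of an interval and the edges joining
    -- consecutive elements of E form two matchings, whose union is bipartite.
    matchings-bipartite : (E : List C) (ρ : C → A × Sign) →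
      AllPairs (λ t t′ → ρ t ≢ ρ t′) E →
      ∃[ ε ] Alternating (endSign ε ∘ ρ) E
    matchings-bipartite []           ρ _ = (λ _ → ⊕) , tt
    matchings-bipartite (_ ∷ [])     ρ _ = (λ _ → ⊕) , tt
    matchings-bipartite (u ∷ v ∷ E) ρ ((u≢v ∷ u≢E) ∷ v≢E ∷ unique)
      with ρ u | ρ v
    ... | a , b | c , d with c ≟ a
    -- The pair consists of the two ends of one interval, opposite under any `ε`.
    ...   | yes refl = let ε , alt = matchings-bipartite E ρ unique in
                       ε , other (ε a) b d (u≢v ∘ cong (a ,_)) , alt
      where
      other : ∀ e b d → b ≢ d → e *ˢ d ≡ opposite (e *ˢ b)
      other e ⊕ ⊕ ne = ⊥-elim (ne refl)
      other e ⊖ ⊖ ne = ⊥-elim (ne refl)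
      other ⊕ ⊕ ⊖ ne = refl
      other ⊖ ⊕ ⊖ ne = refl
      other ⊕ ⊖ ⊕ ne = refl
      other ⊖ ⊖ ⊕ ne = refl
    -- The labels `ρ` vary while the list shrinks. After relabelling, `a` no longer occurs among the
    -- labels of `E`, so its sign can be chosen last.
    ...   | no c≢a =
      let ε , alt = matchings-bipartite E (redirect a (c , d) ∘ ρ)
                      (redirect-unique ρ u≢E v≢E unique)
      in extended c≢a ε , extended-new c≢a ε ,
         alternating-cong (All.map (extended-redirect c≢a ε _) u≢E) alt

  module _ {X : Set₁} (em : ExcludedMiddle (lsuc 0ℓ)) (cut : A × Sign → X → Bool)
           (cut-total : ∀ u v → (∀ x → cut v x ≤ᵇ cut u x) ⊎ (∀ x → cut u x ≤ᵇ cut v x)) where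

    -- Larger cuts come first; for cuts of the line this is the order in which the ends are passed
    -- from left to right. Ends with the same cut count as equal, which gives antisymmetry.
    cutOrder : DecTotalOrder 0ℓ (lsuc 0ℓ) (lsuc 0ℓ)
    cutOrder = record
      { Carrier = A × Sign
      ; _≈_     = λ u v → (∀ x → cut v x ≤ᵇ cut u x) × (∀ x → cut u x ≤ᵇ cut v x)
      ; _≤_     = λ u v → ∀ x → cut v x ≤ᵇ cut u x
      ; isDecTotalOrder = record
        { isTotalOrder = record
          { isPartialOrder = record
            { isPreorder = record
              { isEquivalence = record
                { refl  = (λ _ → Bool.≤-refl) , (λ _ → Bool.≤-refl)
                ; sym   = λ (p , q) → q , p
                ; trans = λ (p , q) (p′ , q′) →
                    (λ x → Bool.≤-trans (p′ x) (p x)) , (λ x → Bool.≤-trans (q x) (q′ x))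
                }
              ; reflexive = proj₁
              ; trans     = λ p q x → Bool.≤-trans (q x) (p x)
              }
            ; antisym = _,_
            }
          ; total = cut-total
          }
        ; _≟_  = λ _ _ → em
        ; _≤?_ = λ _ _ → em
        }
      }

    -- The sum is invariant under permutation, so it may be taken over the sorted ends, where at
    -- each `x` the true cuts form an initial segment.
    twoColouring : ∀ {as} → Unique as → ∃[ ε ] ∀ x →
      ∣ signedSum (endSign ε) (λ u → cut u x) (cartesianProduct as (⊕ ∷ ⊖ ∷ [])) ∣ ≤ 1
    twoColouring {as} unique-as = ε , λ x →
      subst (λ z → ∣ z ∣ ≤ 1)
        (Permutation.foldr-commMonoid (setoid ℤ) ℤ.+-0-isCommutativeMonoid
          (↭⇒↭ₛ (map⁺ (λ u → signed (endSign ε u) (cut u x)) (sort-↭ ends))))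
        (alternating-bound (endSign ε) (λ u → cut u x) (sort ends)
          (AllPairs.map (λ u≤w → u≤w x) sorted) alt)
      where
      open Sort cutOrder
      ends = cartesianProduct as (⊕ ∷ ⊖ ∷ [])
      unique-ends : Unique ends
      unique-ends = Unique.cartesianProduct⁺ unique-as (((λ ()) ∷ []) ∷ [] ∷ [])
      sorted : AllPairs (λ u w → ∀ x → cut w x ≤ᵇ cut u x) (sort ends)
      sorted = Linked⇒AllPairs (λ {u} {v} {w} → DecTotalOrder.trans cutOrder {u} {v} {w}) (sort-↗ ends)
      unique-sorted : Unique (sort ends)
      unique-sorted = Permutation.Unique-resp-↭ (setoid _) (↭⇒↭ₛ (↭-sym (sort-↭ ends))) unique-ends
      bipartite = matchings-bipartite (sort ends) id unique-sorted
      ε = proj₁ bipartite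
      alt = proj₂ bipartite

-- From two colours to k colours

length-filter-sum : ∀ {A : Set} {p} {P : Pred A p} (P? : Decidable P) as →
  length (filter P? as) ≡ sum (map (λ a → bit (does (P? a))) as)
length-filter-sum P? [] = refl
length-filter-sum P? (a ∷ as) with does (P? a)
... | true  = cong suc (length-filter-sum P? as)
... | false = length-filter-sum P? as

sum-map-+ : ∀ {A : Set} (f g : A → ℕ) as →
  sum (map f as) + sum (map g as) ≡ sum (map (λ a → f a + g a) as)
sum-map-+ f g [] = refl
sum-map-+ f g (a ∷ as) = trans
  (solve 4 (λ x y u v → (x :+ u) :+ (y :+ v) := (x :+ y) :+ (u :+ v)) refl
    (f a) (g a) (sum (map f as)) (sum (map g as)))
  (cong (_+_ (f a + g a)) (sum-map-+ f g as))
  where open +-*-Solver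

sum-map-difference : ∀ {A : Set} {f g : A → ℕ} {h : A → ℤ} →
  (∀ a → + f a ≡ + g a +ᶻ h a) → ∀ as →
  + sum (map f as) ≡ + sum (map g as) +ᶻ sumᶻ (map h as)
sum-map-difference eq [] = refl
sum-map-difference {f = f} {g} {h} eq (a ∷ as) = trans
  (cong₂ _+ᶻ_ (eq a) (sum-map-difference eq as))
  (solve 4 (λ x u y v → (x :+ u) :+ (y :+ v) := (x :+ y) :+ (u :+ v)) refl
    (+ g a) (h a) (+ sum (map g as)) (sumᶻ (map h as)))
  where open ℤSolver.+-*-Solver

sum-map-mono : ∀ {ℓ} {A : Set ℓ} {f g : A → ℕ} → (∀ a → f a ≤ g a) → ∀ as →
  sum (map f as) ≤ sum (map g as)
sum-map-mono f≤g []       = z≤n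
sum-map-mono f≤g (a ∷ as) = ℕ.+-mono-≤ (f≤g a) (sum-map-mono f≤g as)

sum-map-mono-< : ∀ {ℓ} {A : Set ℓ} {f g : A → ℕ} → (∀ a → f a ≤ g a) → ∀ {as} →
  Any (λ a → f a < g a) as → sum (map f as) < sum (map g as)
sum-map-mono-< f≤g {a ∷ as} (here f<g) = ℕ.+-mono-<-≤ f<g (sum-map-mono f≤g as)
sum-map-mono-< f≤g {a ∷ as} (there p)  = ℕ.+-mono-≤-< (f≤g a) (sum-map-mono-< f≤g p)

-- That is, `∑ f - f i = ∑ g - g i`, with the subtracted terms moved across to stay in ℕ.
∑-exchange₁ : ∀ {k} {f g : Fin k → ℕ} i → (∀ m → m ≢ i → f m ≡ g m) →
  ∑ f + g i ≡ ∑ g + f i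
∑-exchange₁ {suc k} {f} {g} i eq = begin
  ∑ f + g i                       ≡⟨ cong (_+ g i) (sum-remove f) ⟩
  f i + ∑ (removeAt f i) + g i    ≡⟨ cong (λ r → f i + r + g i)
                                       (sum-cong-≗ (λ m → eq _ (punchInᵢ≢i i m))) ⟩
  f i + ∑ (removeAt g i) + g i    ≡⟨ solve 3 (λ x r y → x :+ r :+ y := y :+ r :+ x) refl
                                       (f i) (∑ (removeAt g i)) (g i) ⟩
  g i + ∑ (removeAt g i) + f i    ≡⟨ cong (_+ f i) (sym (sum-remove g)) ⟩
  ∑ g + f i                       ∎
  where
  open ≡-Reasoning
  open +-*-Solver

-- Two single exchanges through `h`, which takes the value of `g` at `i` and those of `f` elsewhere;
-- `∑ h` is then cancelled.
∑-exchange₂ : ∀ {k} {f g : Fin k → ℕ} {i j} → i ≢ j → (∀ m → m ≢ i → m ≢ j → f m ≡ g m) →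
  ∑ f + (g i + g j) ≡ ∑ g + (f i + f j)
∑-exchange₂ {k} {f} {g} {i} {j} i≢j eq = ℕ.+-cancelʳ-≡ (∑ h) _ _ (begin
  ∑ f + (g i + g j) + ∑ h       ≡⟨ solve 4 (λ F H x y → F :+ (x :+ y) :+ H := (F :+ x) :+ (H :+ y)) refl
                                     (∑ f) (∑ h) (g i) (g j) ⟩
  (∑ f + g i) + (∑ h + g j)     ≡⟨ cong₂ _+_ f∼h h∼g ⟩
  (∑ h + f i) + (∑ g + f j)     ≡⟨ solve 4 (λ G H x y → (H :+ x) :+ (G :+ y) := G :+ (x :+ y) :+ H) refl
                                     (∑ g) (∑ h) (f i) (f j) ⟩
  ∑ g + (f i + f j) + ∑ h       ∎)
  where
  open ≡-Reasoning
  open +-*-Solver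
  h : Fin k → ℕ
  h m = if does (m ≟ i) then g i else f m
  hi : h i ≡ g i
  hi rewrite dec-true (i ≟ i) refl = refl
  h-off : ∀ {m} → m ≢ i → h m ≡ f m
  h-off {m} m≢i rewrite dec-false (m ≟ i) m≢i = refl
  f∼h : ∑ f + g i ≡ ∑ h + f i
  f∼h = trans (cong (_+_ (∑ f)) (sym hi)) (∑-exchange₁ i (λ m m≢i → sym (h-off m≢i)))
  h≡g : ∀ m → m ≢ j → h m ≡ g m
  h≡g m m≢j with m ≟ i
  ... | yes refl = refl
  ... | no m≢i   = eq m m≢i m≢j
  h∼g : ∑ h + g j ≡ ∑ g + f j
  h∼g = trans (∑-exchange₁ j h≡g) (cong (_+_ (∑ g)) (h-off (i≢j ∘ sym)))

-- Sums of two squares with a prescribed total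

sum-of-squares-shifted : ∀ a e → 2 * (a * a + (a + e) * (a + e)) ≡
                               (a + (a + e)) * (a + (a + e)) + ∣ a - a + e ∣ * ∣ a - a + e ∣
sum-of-squares-shifted a e rewrite ℕ.∣m-m+n∣≡n a e = solve 2 (λ a e →
  con 2 :* (a :* a :+ (a :+ e) :* (a :+ e)) := (a :+ (a :+ e)) :* (a :+ (a :+ e)) :+ e :* e) refl a e
  where open +-*-Solver

sum-of-squares-ordered : ∀ {a b} → a ≤ b →
  2 * (a * a + b * b) ≡ (a + b) * (a + b) + ∣ a - b ∣ * ∣ a - b ∣
sum-of-squares-ordered {a} {b} a≤b = subst
  (λ b → 2 * (a * a + b * b) ≡ (a + b) * (a + b) + ∣ a - b ∣ * ∣ a - b ∣)
  (ℕ.m+[n∸m]≡n a≤b) (sum-of-squares-shifted a (b ∸ a))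

-- The parallelogram identity: for a fixed total, the sum of squares depends on the difference alone
-- and grows with it.
sum-of-squares : ∀ a b → 2 * (a * a + b * b) ≡ (a + b) * (a + b) + ∣ a - b ∣ * ∣ a - b ∣
sum-of-squares a b with ℕ.≤-total a b
... | inj₁ a≤b = sum-of-squares-ordered a≤b
... | inj₂ b≤a rewrite ℕ.+-comm (a * a) (b * b) | ℕ.+-comm a b | ℕ.∣-∣-comm a b =
  sum-of-squares-ordered b≤a

module _ {a b c d : ℕ} (a+b≡c+d : a + b ≡ c + d) (c∼d : ∣ c - d ∣ ≤ 1) where

  balanced-double : 2 * (c * c + d * d) ≤ (a + b) * (a + b) + 1
  balanced-double = begin
    2 * (c * c + d * d)                          ≡⟨ sum-of-squares c d ⟩
    (c + d) * (c + d) + ∣ c - d ∣ * ∣ c - d ∣    ≤⟨ ℕ.+-monoʳ-≤ _ (ℕ.*-mono-≤ c∼d c∼d) ⟩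
    (c + d) * (c + d) + 1                        ≡⟨ cong (λ s → s * s + 1) (sym a+b≡c+d) ⟩
    (a + b) * (a + b) + 1                        ∎
    where open ℕ.≤-Reasoning

  -- The doubled inequality carries an error of 1: it has the form 2m ≤ 2n + 1, and integrality
  -- removes the 1.
  balanced-minimal : c * c + d * d ≤ a * a + b * b
  balanced-minimal = ℕ.m<1+n⇒m≤n (ℕ.*-cancelˡ-< 2 _ _ (begin-strict
    2 * (c * c + d * d)                                ≤⟨ balanced-double ⟩
    (a + b) * (a + b) + 1                              ≤⟨ ℕ.+-monoˡ-≤ 1 (ℕ.m≤m+n _ _) ⟩
    (a + b) * (a + b) + ∣ a - b ∣ * ∣ a - b ∣ + 1      ≡⟨ cong (_+ 1) (sym (sum-of-squares a b)) ⟩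
    2 * (a * a + b * b) + 1                            <⟨ ℕ.+-monoʳ-< (2 * (a * a + b * b)) (s≤s (s≤s z≤n)) ⟩
    2 * (a * a + b * b) + 2                            ≡⟨ ℕ.+-comm _ 2 ⟩
    2 + 2 * (a * a + b * b)                            ≡⟨ sym (ℕ.*-suc 2 _) ⟩
    2 * suc (a * a + b * b)                            ∎))
    where open ℕ.≤-Reasoning

  balanced-smaller : 1 < ∣ a - b ∣ → c * c + d * d < a * a + b * b
  balanced-smaller a≁b = ℕ.*-cancelˡ-< 2 _ _ (begin-strict
    2 * (c * c + d * d)                                ≤⟨ balanced-double ⟩
    -- A gap of at least 2 has square at least 4, which beats the error 1.
    (a + b) * (a + b) + 1                              <⟨ ℕ.+-monoʳ-< _ (ℕ.≤-trans (s≤s (s≤s z≤n)) (ℕ.*-mono-≤ a≁b a≁b)) ⟩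
    (a + b) * (a + b) + ∣ a - b ∣ * ∣ a - b ∣          ≡⟨ sym (sum-of-squares a b) ⟩
    2 * (a * a + b * b)                                ∎)
    where open ℕ.≤-Reasoning

-- Descent to an equitable colouring

∣-∣≤∣difference∣ : ∀ c d z → + c ≡ + d +ᶻ z → ∣ c - d ∣ ≤ ∣ z ∣
∣-∣≤∣difference∣ c d (+ e) eq rewrite ℤ.+-injective eq = ℕ.≤-reflexive (trans (ℕ.∣-∣-comm (d + e) d) (ℕ.∣m-m+n∣≡n d e))
∣-∣≤∣difference∣ c d -[1+ e ] eq = ℕ.≤-reflexive (trans (cong (∣ c -_∣) d≡c+e) (ℕ.∣m-m+n∣≡n c (suc e)))
  where
  open ℤSolver.+-*-Solver
  d≡c+e : d ≡ c + suc e
  d≡c+e = ℤ.+-injective (trans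
    (solve 2 (λ x y → x := x :+ (:- y) :+ y) refl (+ d) (+ suc e))
    (cong (_+ᶻ + suc e) (sym eq)))

-- The potential has to be a finite sum although `X` may be infinite. `P` collects the values
-- already fixed: each step splits on the next function, and at the end excluded middle tells
-- whether the pattern occurs at all.
patternCover : ∀ {X : Set₁} → ExcludedMiddle (lsuc 0ℓ) → ∀ {n} (v : Fin n → X → Bool) (P : X → Set₁) →
  ∃[ xs ] ∀ x → P x → Any (λ y → P y × ∀ a → v a x ≡ v a y) xs
patternCover em {zero} v P with em {∃ P}
... | yes (y , py) = y ∷ [] , λ _ _ → here (py , λ ())
... | no ¬∃        = [] , λ x px → ⊥-elim (¬∃ (x , px))
patternCover {X} em {suc n} v P = xs true ++ xs false , λ x px → cover x px (v fzero x) refl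
  where
  P∧ : Bool → X → Set₁
  P∧ b x = P x × v fzero x ≡ b
  ih : ∀ b → ∃[ xs ] ∀ x → P∧ b x → Any (λ y → P∧ b y × ∀ a → v (fsuc a) x ≡ v (fsuc a) y) xs
  ih b = patternCover em (v ∘ fsuc) (P∧ b)
  xs : Bool → List X
  xs b = proj₁ (ih b)
  found : ∀ {b} x → P x → v fzero x ≡ b → Any (λ y → P y × ∀ a → v a x ≡ v a y) (xs b)
  found {b} x px eq = Any.map
    (λ { ((py , eq′) , eqs) → py , λ { fzero → trans eq (sym eq′) ; (fsuc a) → eqs a } })
    (proj₂ (ih b) x (px , eq))
  cover : ∀ x → P x → ∀ b → v fzero x ≡ b → Any (λ y → P y × ∀ a → v a x ≡ v a y) (xs true ++ xs false)
  cover x px true  eq = ++⁺ˡ (found x px eq)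
  cover x px false eq = ++⁺ʳ (xs true) (found x px eq)

-- The geometry is reduced to one hypothesis: every subfamily, given by `active`, has signs whose
-- sum over its members at any point has absolute value at most 1.
module EquitableColouring {X : Set₁} (em : ExcludedMiddle (lsuc 0ℓ)) {n : ℕ}
         {p : Level} {Mem : X → Fin n → Set p} (mem? : ∀ x a → Dec (Mem x a))
         (bicolouring : ∀ (active : Fin n → Bool) → ∃[ ε ] ∀ x →
           ∣ signedSum ε (λ a → active a ∧ does (mem? x a)) (allFin n) ∣ ≤ 1) where

  module _ {k : ℕ} where

    count : (Fin n → Fin k) → Fin k → X → ℕ
    count χ i x = length (filter (λ a → mem? x a ×-dec (χ a ≟ i)) (allFin n))

    count-sum : ∀ χ i x →
      count χ i x ≡ sum (map (λ a → bit (does (mem? x a) ∧ does (χ a ≟ i))) (allFin n))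
    count-sum χ i x = length-filter-sum (λ a → mem? x a ×-dec (χ a ≟ i)) (allFin n)

    count-cong : ∀ χ i {x y} → (∀ a → does (mem? x a) ≡ does (mem? y a)) → count χ i x ≡ count χ i y
    count-cong χ i {x} {y} eq = trans (count-sum χ i x) (trans
      (cong sum (map-cong (λ a → cong (λ b → bit (b ∧ does (χ a ≟ i))) (eq a)) (allFin n)))
      (sym (count-sum χ i y)))

    squares : (Fin n → Fin k) → X → ℕ
    squares χ x = ∑ (λ i → count χ i x * count χ i x)

    Equitable : (Fin n → Fin k) → Set₁
    Equitable χ = ∀ x i j → ∣ count χ i x - count χ j x ∣ ≤ 1

    module _ (χ : Fin n → Fin k) {i j : Fin k} (i≢j : i ≢ j) where

      active : Fin n → Bool
      active a = does (χ a ≟ i) ∨ does (χ a ≟ j)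

      pick : Sign → Fin k
      pick ⊕ = i
      pick ⊖ = j

      recolour : (Fin n → Sign) → Fin n → Fin k
      recolour ε a = if active a then pick (ε a) else χ a

      pick-difference : ∀ s b →
        + bit (b ∧ does (pick s ≟ i)) ≡ + bit (b ∧ does (pick s ≟ j)) +ᶻ signed s b
      pick-difference ⊕ true  rewrite dec-true (i ≟ i) refl | dec-false (i ≟ j) i≢j = refl
      pick-difference ⊖ true  rewrite dec-true (j ≟ j) refl | dec-false (j ≟ i) (i≢j ∘ sym) = refl
      pick-difference ⊕ false = refl
      pick-difference ⊖ false = refl

      pick-sum : ∀ s b → bit (b ∧ does (pick s ≟ i)) + bit (b ∧ does (pick s ≟ j)) ≡ bit b
      pick-sum ⊕ true  rewrite dec-true (i ≟ i) refl | dec-false (i ≟ j) i≢j = refl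
      pick-sum ⊖ true  rewrite dec-true (j ≟ j) refl | dec-false (j ≟ i) (i≢j ∘ sym) = refl
      pick-sum ⊕ false = refl
      pick-sum ⊖ false = refl

      pick-other : ∀ {m} → m ≢ i → m ≢ j → ∀ s → does (pick s ≟ m) ≡ false
      pick-other m≢i m≢j ⊕ = dec-false (i ≟ _) (m≢i ∘ sym)
      pick-other m≢i m≢j ⊖ = dec-false (j ≟ _) (m≢j ∘ sym)

      module _ (ε : Fin n → Sign) (x : X) where

        recolour-difference : ∀ a →
          + bit (does (mem? x a) ∧ does (recolour ε a ≟ i)) ≡
          + bit (does (mem? x a) ∧ does (recolour ε a ≟ j)) +ᶻ signed (ε a) (active a ∧ does (mem? x a))
        recolour-difference a with χ a ≟ i in eqᵢ | χ a ≟ j in eqⱼ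
        ... | yes _ | _     = pick-difference (ε a) _
        ... | no _  | yes _ = pick-difference (ε a) _
        ... | no _  | no _  rewrite eqᵢ | eqⱼ with does (mem? x a) | ε a
        ...   | true  | ⊕ = refl
        ...   | true  | ⊖ = refl
        ...   | false | ⊕ = refl
        ...   | false | ⊖ = refl

        recolour-sum : ∀ a →
          bit (does (mem? x a) ∧ does (χ a ≟ i)) + bit (does (mem? x a) ∧ does (χ a ≟ j)) ≡
          bit (does (mem? x a) ∧ does (recolour ε a ≟ i)) + bit (does (mem? x a) ∧ does (recolour ε a ≟ j))
        recolour-sum a with χ a ≟ i in eqᵢ | χ a ≟ j in eqⱼ
        ... | yes χa≡i | yes χa≡j = ⊥-elim (i≢j (trans (sym χa≡i) χa≡j))
        ... | yes _ | no _  = trans (left (does (mem? x a))) (sym (pick-sum (ε a) _))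
          where
          left : ∀ b → bit (b ∧ true) + bit (b ∧ false) ≡ bit b
          left true  = refl
          left false = refl
        ... | no _ | yes _  = trans (right (does (mem? x a))) (sym (pick-sum (ε a) _))
          where
          right : ∀ b → bit (b ∧ false) + bit (b ∧ true) ≡ bit b
          right true  = refl
          right false = refl
        ... | no _ | no _ rewrite eqᵢ | eqⱼ = refl

        recolour-other : ∀ {m} → m ≢ i → m ≢ j → ∀ a →
          does (recolour ε a ≟ m) ≡ does (χ a ≟ m)
        recolour-other {m} m≢i m≢j a with χ a ≟ i | χ a ≟ j
        ... | yes χa≡i | _ = trans (pick-other m≢i m≢j (ε a))
                               (sym (dec-false (χ a ≟ m) (λ χa≡m → m≢i (trans (sym χa≡m) χa≡i))))
        ... | no _ | yes χa≡j = trans (pick-other m≢i m≢j (ε a))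
                               (sym (dec-false (χ a ≟ m) (λ χa≡m → m≢j (trans (sym χa≡m) χa≡j))))
        ... | no _ | no _ = refl

        -- Term by term: an active interval through `x` counts +1 if it received `i` and -1 if it
        -- received `j`; every other interval counts 0 on both sides.
        count-difference : + count (recolour ε) i x ≡ + count (recolour ε) j x
          +ᶻ signedSum ε (λ a → active a ∧ does (mem? x a)) (allFin n)
        count-difference rewrite count-sum (recolour ε) i x | count-sum (recolour ε) j x =
          sum-map-difference recolour-difference (allFin n)

        -- Intervals only move between `i` and `j`, so the total is fixed and the sums of squares
        -- before and after can be compared.
        count-+ : count χ i x + count χ j x ≡ count (recolour ε) i x + count (recolour ε) j x
        count-+ = begin
          count χ i x + count χ j x ≡⟨ cong₂ _+_ (count-sum χ i x) (count-sum χ j x) ⟩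
          _                         ≡⟨ sum-map-+ _ _ (allFin n) ⟩
          _                         ≡⟨ cong sum (map-cong recolour-sum (allFin n)) ⟩
          _                         ≡⟨ sum-map-+ _ _ (allFin n) ⟨
          _                         ≡⟨ cong₂ _+_ (count-sum χ′ i x) (count-sum χ′ j x) ⟨
          count χ′ i x + count χ′ j x ∎
          where
          open ≡-Reasoning
          χ′ = recolour ε

        count-other : ∀ m → m ≢ i → m ≢ j → count (recolour ε) m x ≡ count χ m x
        count-other m m≢i m≢j = trans (count-sum (recolour ε) m x) (trans
          (cong sum (map-cong (λ a → cong (λ b → bit (does (mem? x a) ∧ b)) (recolour-other m≢i m≢j a)) (allFin n)))
          (sym (count-sum χ m x)))

        module _ (bound : ∣ signedSum ε (λ a → active a ∧ does (mem? x a)) (allFin n) ∣ ≤ 1) where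

          private
            χ′ = recolour ε
            sq : (Fin n → Fin k) → Fin k → ℕ
            sq ψ m = count ψ m x * count ψ m x

            χ′-balanced : ∣ count χ′ i x - count χ′ j x ∣ ≤ 1
            χ′-balanced = ℕ.≤-trans (∣-∣≤∣difference∣ (count χ′ i x) _ (signedSum ε _ (allFin n)) count-difference) bound

            exchange : squares χ′ x + (sq χ i + sq χ j) ≡ squares χ x + (sq χ′ i + sq χ′ j)
            exchange = ∑-exchange₂ {f = sq χ′} {g = sq χ} i≢j
              (λ m m≢i m≢j → cong (λ c → c * c) (count-other m m≢i m≢j))

          -- Required at every point: repairing one point must not raise the sum elsewhere, even
          -- where the two colours were balanced already.
          squares-≤ : squares χ′ x ≤ squares χ x
          squares-≤ = ℕ.+-cancelʳ-≤ (sq χ i + sq χ j) _ _ (ℕ.≤-trans (ℕ.≤-reflexive exchange)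
            (ℕ.+-monoʳ-≤ (squares χ x)
              (balanced-minimal {count χ i x} {count χ j x} {count χ′ i x} {count χ′ j x} count-+ χ′-balanced)))

          squares-< : 1 < ∣ count χ i x - count χ j x ∣ → squares χ′ x < squares χ x
          squares-< bad = ℕ.+-cancelʳ-< (sq χ i + sq χ j) _ _ (ℕ.≤-<-trans (ℕ.≤-reflexive exchange)
            (ℕ.+-monoʳ-< (squares χ x)
              (balanced-smaller {count χ i x} {count χ j x} {count χ′ i x} {count χ′ j x} count-+ χ′-balanced bad)))

    -- The trivial predicate starts the recursion without restriction. Counts depend on the
    -- membership pattern only, so these points represent all of `X`.
    sample : ∃[ xs ] ∀ x → Lift _ ⊤ → Any (λ y → Lift _ ⊤ × ∀ a → does (mem? x a) ≡ does (mem? y a)) xs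
    sample = patternCover em (λ a x → does (mem? x a)) (λ _ → Lift _ ⊤)

    potential : (Fin n → Fin k) → ℕ
    potential χ = sum (map (squares χ) (proj₁ sample))

    improve : ∀ χ → (∃[ x ] ∃[ i ] ∃[ j ] 1 < ∣ count χ i x - count χ j x ∣) →
      ∃[ χ′ ] potential χ′ < potential χ
    improve χ (x , i , j , bad) = recolour χ i≢j ε ,
      sum-map-mono-< (λ y → squares-≤ χ i≢j ε y (bound y))
        -- The bad point `x` may lie outside the sample; a sample point `y` with the same pattern
        -- has the same counts, and there the decrease is strict.
        (Any.map (λ {y} (_ , eq) → squares-< χ i≢j ε y (bound y)
            (subst (1 <_) (cong₂ ∣_-_∣ (count-cong χ i eq) (count-cong χ j eq)) bad))
          (proj₂ sample x _))
      where
      i≢j : i ≢ j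
      i≢j refl = ℕ.<-asym bad (subst (_< 1) (sym (ℕ.∣n-n∣≡0 (count χ i x))) (s≤s z≤n))
      ε = proj₁ (bicolouring (active χ i≢j))
      bound = proj₂ (bicolouring (active χ i≢j))

    equitable-from : ∀ χ → Acc _<_ (potential χ) → ∃ Equitable
    equitable-from χ (acc rec) with em {∃[ x ] ∃[ i ] ∃[ j ] 1 < ∣ count χ i x - count χ j x ∣}
    ... | no ¬bad = χ , λ x i j → ℕ.≮⇒≥ (λ bad → ¬bad (x , i , j , bad))
    ... | yes bad = let χ′ , smaller = improve χ bad in equitable-from χ′ (rec smaller)

  equitable : ∀ k → .{{NonZero k}} → ∃ (Equitable {k})
  -- Any colouring can start the descent; with at least one colour a constant one is available.
  equitable (suc k) = equitable-from (λ _ → fzero) (<-wellFounded _)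

-- Intervals of reals

-- A maximum has to be attained: this point witnesses the value 0 when no point has imbalance 1.
0ℝ : ℝ
0ℝ = record
  { L = _<ᵠ 0ℚ
  ; U = 0ℚ <ᵠ_
  ; L-inhabited = ℚ.- 1ℚ , toWitness {a? = (ℚ.- 1ℚ) ℚ.<? 0ℚ} _
  ; U-inhabited = 1ℚ , toWitness {a? = 0ℚ ℚ.<? 1ℚ} _
  ; L-rounded = λ q → mk⇔ ℚ.<-dense (λ (r , q<r , r<0) → ℚ.<-trans q<r r<0)
  ; U-rounded = λ q → mk⇔ (λ 0<q → let r , 0<r , r<q = ℚ.<-dense 0<q in r , r<q , 0<r)
                          (λ (r , r<q , 0<r) → ℚ.<-trans 0<r r<q)
  ; disjoint = λ q (q<0 , 0<q) → ℚ.<-asym q<0 0<q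
  ; located = λ q r q<r → located q r q<r
  }
  where
  located : ∀ q r → q <ᵠ r → q <ᵠ 0ℚ ⊎ 0ℚ <ᵠ r
  located q r q<r with ℚ.<-cmp q 0ℚ
  ... | tri< q<0 _ _  = inj₁ q<0
  ... | tri≈ _ refl _ = inj₂ q<r
  ... | tri> _ _ 0<q  = inj₂ (ℚ.<-trans 0<q q<r)

≤ʳ-trans : ∀ {x y z} → x ≤ʳ y → y ≤ʳ z → x ≤ʳ z
≤ʳ-trans x≤y y≤z q = y≤z q ∘ x≤y q

L-downward : ∀ x {q r} → q <ᵠ r → ℝ.L x r → ℝ.L x q
L-downward x {q} {r} q<r Lr = Equivalence.from (ℝ.L-rounded x q) (r , q<r , Lr)

does-mono : ∀ {p q} {P : Set p} {Q : Set q} (P? : Dec P) (Q? : Dec Q) → (P → Q) → does P? ≤ᵇ does Q?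
does-mono (yes p) (yes q) _ = b≤b
does-mono (yes p) (no ¬q) f = ⊥-elim (¬q (f p))
does-mono (no ¬p) (yes q) _ = f≤t
does-mono (no ¬p) (no ¬q) _ = b≤b

module _ (em : ExcludedMiddle (lsuc 0ℓ)) where

  em₀ : ExcludedMiddle 0ℓ
  em₀ = map′ lower lift em

  -- A rational in the lower cut of `x` but not in that of `y` bounds the latter, which then lies
  -- inside the former; without such a rational the inclusion is reversed.
  ≤ʳ-total : ∀ x y → x ≤ʳ y ⊎ y ≤ʳ x
  ≤ʳ-total x y with em₀ {∃[ q ] (ℝ.L x q × ¬ ℝ.L y q)}
  ... | no ¬∃ = inj₁ λ q Lxq → decidable-stable em₀ (λ ¬Lyq → ¬∃ (q , Lxq , ¬Lyq))
  ... | yes (q , Lxq , ¬Lyq) = inj₂ λ r → below r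
    where
    below : ∀ r → ℝ.L y r → ℝ.L x r
    below r Lyr with ℚ.<-cmp r q
    ... | tri< r<q _ _  = L-downward x r<q Lxq
    ... | tri≈ _ refl _ = Lxq
    ... | tri> _ _ q<r  = ⊥-elim (¬Lyq (L-downward y q<r Lyr))

  ≰ʳ⇒≥ʳ : ∀ {x y} → ¬ x ≤ʳ y → y ≤ʳ x
  ≰ʳ⇒≥ʳ {x} {y} x≰y with ≤ʳ-total x y
  ... | inj₁ x≤y = ⊥-elim (x≰y x≤y)
  ... | inj₂ y≤x = y≤x

  module _ {n : ℕ} (I : Fin n → ClosedInterval) where

    private
      left right : Fin n → ℝ
      left  a = ClosedInterval.left (I a)
      right a = ClosedInterval.right (I a)

    -- The asymmetry encodes closedness: a left end is passed on arrival, a right end only strictly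
    -- beyond it.
    Reached : Fin n × Sign → ℝ → Set
    Reached (a , ⊕) x = left a ≤ʳ x
    Reached (a , ⊖) x = ¬ (x ≤ʳ right a)

    reached? : ∀ u x → Dec (Reached u x)
    reached? (a , ⊕) x = em₀
    reached? (a , ⊖) x = ¬? em₀

    -- Ties are settled here: when a left and a right end coincide, the left one is reached first.
    left-right-total : ∀ a b → (∀ x → Reached (a , ⊕) x → Reached (b , ⊖) x) ⊎
                               (∀ x → Reached (b , ⊖) x → Reached (a , ⊕) x)
    left-right-total a b with em₀ {left a ≤ʳ right b}
    ... | yes l≤r = inj₂ λ x x≰r → ≤ʳ-trans {left a} {right b} {x} l≤r (≰ʳ⇒≥ʳ {x} {right b} x≰r)
    ... | no  l≰r = inj₁ λ x l≤x x≤r → l≰r (≤ʳ-trans {left a} {x} {right b} l≤x x≤r)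

    reached-total : ∀ u v → (∀ x → Reached u x → Reached v x) ⊎ (∀ x → Reached v x → Reached u x)
    reached-total (a , ⊕) (b , ⊖) = left-right-total a b
    reached-total (a , ⊖) (b , ⊕) = Sum.swap (left-right-total b a)
    reached-total (a , ⊕) (b , ⊕) with ≤ʳ-total (left a) (left b)
    ... | inj₁ a≤b = inj₂ λ x → ≤ʳ-trans {left a} {left b} {x} a≤b
    ... | inj₂ b≤a = inj₁ λ x → ≤ʳ-trans {left b} {left a} {x} b≤a
    reached-total (a , ⊖) (b , ⊖) with ≤ʳ-total (right a) (right b)
    ... | inj₁ a≤b = inj₂ λ x x≰b x≤a → x≰b (≤ʳ-trans {x} {right a} {right b} x≤a a≤b)
    ... | inj₂ b≤a = inj₁ λ x x≰a x≤b → x≰a (≤ʳ-trans {x} {right b} {right a} x≤b b≤a)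

    module _ (active : Fin n → Bool) where

      -- Inactive intervals keep their ends, with empty cuts: these add 0 to every signed sum and
      -- are comparable with all cuts.
      cut : Fin n × Sign → ℝ → Bool
      cut u x = active (proj₁ u) ∧ does (reached? u x)

      cut-total : ∀ u v → (∀ x → cut v x ≤ᵇ cut u x) ⊎ (∀ x → cut u x ≤ᵇ cut v x)
      cut-total u v with active (proj₁ u) | active (proj₁ v)
      ... | false | _     = inj₂ λ _ → Bool.≤-minimum _
      ... | true  | false = inj₁ λ _ → Bool.≤-minimum _
      ... | true  | true  = Sum.swap (Sum.map
              (λ u⊆v x → does-mono (reached? u x) (reached? v x) (u⊆v x))
              (λ v⊆u x → does-mono (reached? v x) (reached? u x) (v⊆u x))
              (reached-total u v))

      -- Before an active interval neither end counts, inside it only the left one, and beyond it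
      -- the two cancel.
      signed-membership : ∀ s x a →
        signed (s *ˢ ⊕) (cut (a , ⊕) x) +ᶻ signed (s *ˢ ⊖) (cut (a , ⊖) x) ≡
        signed s (active a ∧ does (_∈?_ em x (I a)))
      signed-membership s x a with active a
      ... | false = inactive s
        where
        inactive : ∀ s → signed (s *ˢ ⊕) false +ᶻ signed (s *ˢ ⊖) false ≡ signed s false
        inactive ⊕ = refl
        inactive ⊖ = refl
      ... | true = telescope s em₀ em₀ (_∈?_ em x (I a))
        where
        telescope : ∀ s (l? : Dec (left a ≤ʳ x)) (r? : Dec (x ≤ʳ right a)) (m? : Dec (x ∈ᴵ I a)) →
          signed (s *ˢ ⊕) (does l?) +ᶻ signed (s *ˢ ⊖) (does (¬? r?)) ≡ signed s (does m?)
        -- Here `x` would lie before the left end and after the right one, against `left≤right`.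
        telescope s (no l≰x) (no x≰r) _ = ⊥-elim (x≰r (≤ʳ-trans {x} {left a} {right a}
          (≰ʳ⇒≥ʳ {left a} {x} l≰x) (ClosedInterval.left≤right (I a))))
        telescope s (yes l≤x) (yes x≤r) (no x∉I) = ⊥-elim (x∉I (l≤x , x≤r))
        telescope s (no l≰x)  _         (yes (l≤x , _)) = ⊥-elim (l≰x l≤x)
        telescope s _         (no x≰r)  (yes (_ , x≤r)) = ⊥-elim (x≰r x≤r)
        telescope ⊕ (yes _) (yes _) (yes _) = refl
        telescope ⊖ (yes _) (yes _) (yes _) = refl
        telescope ⊕ (yes _) (no _)  (no _)  = refl
        telescope ⊖ (yes _) (no _)  (no _)  = refl
        telescope ⊕ (no _)  (yes _) (no _)  = refl
        telescope ⊖ (no _)  (yes _) (no _)  = refl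

      signedSum-ends : ∀ ε x as →
        signedSum (endSign _≟_ ε) (λ u → cut u x) (cartesianProduct as (⊕ ∷ ⊖ ∷ [])) ≡
        signedSum ε (λ a → active a ∧ does (_∈?_ em x (I a))) as
      signedSum-ends ε x []       = refl
      signedSum-ends ε x (a ∷ as) = trans
        (sym (ℤ.+-assoc (signed (ε a *ˢ ⊕) (cut (a , ⊕) x)) (signed (ε a *ˢ ⊖) (cut (a , ⊖) x)) _))
        (cong₂ _+ᶻ_ (signed-membership (ε a) x a) (signedSum-ends ε x as))

      intervalBicolouring : ∃[ ε ] ∀ x →
        ∣ signedSum ε (λ a → active a ∧ does (_∈?_ em x (I a))) (allFin n) ∣ ≤ 1
      intervalBicolouring =
        let ε , bound = twoColouring _≟_ em cut cut-total (Unique.allFin⁺ n)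
        in ε , λ x → subst (λ z → ∣ z ∣ ≤ 1) (signedSum-ends ε x (allFin n)) (bound x)

  -- The domain may be infinite, but the bound leaves only the values 0 and 1, and excluded middle
  -- decides whether 1 occurs.
  maximum-exists : ∀ {A : Set₁} (f : A → ℕ) → A → (∀ x → f x ≤ 1) → ∃[ m ] (IsMaximumOf f m × m ≤ 1)
  maximum-exists f x₀ f≤1 with em {∃[ x ] f x ≡ 1}
  ... | yes attained = 1 , (attained , f≤1) , ℕ.≤-refl
  ... | no ¬attained = 0 , ((x₀ , ℕ.n≤0⇒n≡0 (f≤0 x₀)) , f≤0) , z≤n
    where
    f≤0 : ∀ x → f x ≤ 0
    f≤0 x = ℕ.m<1+n⇒m≤n (ℕ.≤∧≢⇒< (f≤1 x) (λ eq → ¬attained (x , eq)))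

theorem1 : (em : ExcludedMiddle (lsuc 0ℓ)) →
    (n : ℕ) (I : Fin n → ClosedInterval) → Injective _≡_ _≈ᴵ_ I →
    (k : ℕ) → .{{_ : NonZero k}} →
    ∃[ χ ] Balanced em {n} {k} I χ
theorem1 em n I _ k =
  let χ , eq = EquitableColouring.equitable em (λ x a → _∈?_ em x (I a)) (intervalBicolouring em I) k
  in χ , maximum-exists em (imbalanceAt em I χ) 0ℝ λ x →
       -- `z≤n` accounts for the default value 0 of `max`; the rest bounds the entries of the list.
       max≤v⁺ z≤n (All.map⁺ (All.universal (λ (i , j) → eq x i j)
         (cartesianProduct (allFin k) (allFin k))))
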